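{- Let $f(x)\in\mathbb{Z}[x]$ be such that $0$ is a strictly preperiodic point of the map $x\mapsto f(x)$. Let $\ell(f)=\operatorname{lcm}[f(0),f^2(0)]$. Let $x_0$ be an integer with a wandering orbit $(x_n)_{n\ge 0}$ under $f$, and define \[ a_n=\frac{x_n}{\gcd(x_n,\ell(f))}\quad\text{for all } n\ge 0. \] Then $(a_n)_{n\ge0}$ is an infinite sequence of pairwise coprime integers, and for every $n\ge 3$, $a_n$ has a private prime factor.
   Context: For a polynomial $f$, $f^n$ denotes the $n$-fold composition of $f$ with itself ($f^0$ is the identity). The orbit of $x_0$ under $f$ is the sequence $x_n=f^n(x_0)$, $n\ge0$. A point $\alpha$ is periodic if $f^n(\alpha)=\alpha$ for some $n\ge1$; preperiodic if $f^m(\alpha)$ is periodic for some $m\ge0$; strictly preperiodic if it is preperiodic but not periodic; and it has a wandering orbit if it is not preperiodic, i.e. the values $f^m(\alpha)$, $m\ge0$, are pairwise distinct. For a sequence of integers $(a_n)$, a prime $p$ is a private prime factor of $a_n$ if $p$ divides $a_n$ and divides no other term $a_m$, $m\neq n$. -}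

module Defs where

open import Data.Nat using (ℕ; zero; suc)
open import Data.Integer using (ℤ; _+_; _*_; 0ℤ; ∣_∣; _/ℕ_)
open import Data.Integer.GCD using (gcd)
open import Data.Integer.LCM using (lcm)
open import Data.List using (List; []; _∷_)
open import Relation.Binary.PropositionalEquality using (_≡_; _≢_)
open import Data.Product using (Σ; _×_)
open import Relation.Nullary using (¬_)

-- A polynomial in ℤ[x], given by its coefficient list [c₀, c₁, …, c_d]
-- (lowest degree first), i.e. c₀ + c₁ x + … + c_d x^d.
Poly : Set
Poly = List ℤ

eval : Poly → ℤ → ℤ
eval []       x = 0ℤ
eval (c ∷ cs) x = c + x * eval cs x

iter : Poly → ℕ → ℤ → ℤ
iter f zero    x = x
iter f (suc n) x = eval f (iter f n x)

Periodic : Poly → ℤ → Set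
Periodic f α = Σ ℕ λ n → iter f (suc n) α ≡ α

Preperiodic : Poly → ℤ → Set
Preperiodic f α = Σ ℕ λ m → Periodic f (iter f m α)

StrictlyPreperiodic : Poly → ℤ → Set
StrictlyPreperiodic f α = Preperiodic f α × ¬ Periodic f α

Wandering : Poly → ℤ → Set
Wandering f α = ∀ m n → m ≢ n → iter f m α ≢ iter f n α

ell : Poly → ℤ
ell f = lcm (iter f 1 0ℤ) (iter f 2 0ℤ)

-- Exact division x / g for g a natural number; for g = 0 returns x
-- (a junk value, never used under the theorem's hypotheses since ℓ(f) ≠ 0).
divBy : ℤ → ℕ → ℤ
divBy x zero    = x
divBy x (suc k) = x /ℕ suc k

aSeq : Poly → ℤ → ℕ → ℤ
aSeq f x₀ n = divBy (iter f n x₀) ∣ gcd (iter f n x₀) (ell f) ∣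

{-# OPTIONS --safe #-}
module Submission where

-- Write b_k = f^k(0). Integer cycles have length at most 2, and b_k divides
-- b_{k+j} − b_j, so every b_k with k ≥ 1 divides b₁ or b₂, hence ℓ = ℓ(f), and
-- ℓ = ±b₂. Since x_m divides x_{m+k} − b_k, common divisors of two terms divide
-- ℓ; dividing out gcd(x_n, ℓ) therefore leaves pairwise coprime numbers.
--
-- It remains to see that x_n does not divide ℓ when n ≥ 3. One has b₃ = ±b₁. If
-- b₃ = b₁ then f takes the value b₁ at 0 and at b₂, so y (y − b₂) divides
-- f(y) − b₁; if b₃ = −b₁ then b₄ = b₂, so f takes the value b₂ at ±b₁ and
-- y² − b₁² divides f(y) − b₂. For y = x_{n−3}, x_{n−2}, x_{n−1} these
-- divisibilities force |b₂| ≤ 6 as soon as x_n divides b₂, and a finite search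
-- excludes what is left.

open import Defs
open import Data.Nat using (ℕ; _≥_)
open import Data.Nat.Primality using (Prime)
open import Data.Integer using (ℤ; +_)
open import Data.Integer.Divisibility using (_∣_)
open import Data.Integer.Coprimality using (Coprime)
open import Data.Product using (Σ; _×_)
open import Relation.Nullary using (¬_)
open import Relation.Binary.PropositionalEquality using (_≢_)

open import Data.Empty using (⊥)
open import Data.Integer
  using (-[1+_]; -_; 0ℤ; _+_; _-_; _*_; ∣_∣; _≟_; _/ℕ_; _%ℕ_)
open import Data.Integer.Divisibility.Signed
  using (divides; ∣⇒∣ᵤ; ∣ᵤ⇒∣; ∣-trans; ∣-refl; 0∣⇒≡0;
         ∣m∣n⇒∣m+n; ∣m∣n⇒∣m-n; ∣m⇒∣-m; ∣m⇒∣m*n; *-monoʳ-∣)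
  renaming (_∣_ to _∣ˢ_; _∣?_ to _∣ˢ?_)
import Data.Integer.DivMod as ℤ
import Data.Integer.GCD as ℤ
import Data.Integer.LCM as ℤ
import Data.Integer.Properties as ℤ
open import Data.Integer.Tactic.RingSolver using (solve-∀)
open import Data.List using ([]; _∷_)
open import Data.List.Relation.Unary.All using (_∷_)
open import Data.Nat as ℕ using (zero; suc; _≤_; s≤s; z≤n)
import Data.Nat.Coprimality as ℕ
import Data.Nat.Divisibility as ℕ
import Data.Nat.GCD as ℕ
open import Data.Nat.Primality using (prime[2]; ¬prime[1])
open import Data.Nat.Primality.Factorisation using (factorise)
import Data.Nat.Properties as ℕ
import Data.Nat.Tactic.RingSolver as ℕ-solver
open import Data.Product using (_,_; proj₁; proj₂)
open import Data.Sum using (_⊎_; inj₁; inj₂; [_,_]′)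
open import Data.Unit using (tt)
open import Function using (_∘_)
open import Relation.Binary.Definitions using (tri<; tri≈; tri>)
open import Relation.Binary.PropositionalEquality
  using (_≡_; refl; sym; trans; cong; cong₂; subst; subst₂; module ≡-Reasoning)
open import Relation.Nullary using (Dec; yes; no; contradiction)
open import Relation.Nullary.Decidable using (map′; toWitness; ¬?; _×-dec_; _⊎-dec_; _→-dec_)

-- Signs and divisibility in ℤ.

i-[i-j]≡j : ∀ i j → i - (i - j) ≡ j
i-[i-j]≡j = solve-∀

≢⇒-≢0 : ∀ {i j} → i ≢ j → i - j ≢ 0ℤ
≢⇒-≢0 i≢j = i≢j ∘ ℤ.i-j≡0⇒i≡j _ _

∣∣≡⇒≡⊎≡- : ∀ {i j} → ∣ i ∣ ≡ ∣ j ∣ → i ≡ j ⊎ i ≡ - j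
∣∣≡⇒≡⊎≡- {i} {j} eq with ℤ.+∣i∣≡i⊎+∣i∣≡-i i | ℤ.+∣i∣≡i⊎+∣i∣≡-i j
... | inj₁ p | inj₁ q = inj₁ (trans (sym p) (trans (cong +_ eq) q))
... | inj₁ p | inj₂ q = inj₂ (trans (sym p) (trans (cong +_ eq) q))
... | inj₂ p | inj₁ q =
  inj₂ (trans (sym (ℤ.neg-involutive i)) (cong -_ (trans (sym p) (trans (cong +_ eq) q))))
... | inj₂ p | inj₂ q = inj₁ (ℤ.neg-injective (trans (sym p) (trans (cong +_ eq) q)))

∣-antisym : ∀ {i j} → i ∣ˢ j → j ∣ˢ i → i ≡ j ⊎ i ≡ - j
∣-antisym p q = ∣∣≡⇒≡⊎≡- (ℕ.∣-antisym (∣⇒∣ᵤ p) (∣⇒∣ᵤ q))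

∣⇒∣∣≤ : ∀ {i j} → i ∣ˢ j → j ≢ 0ℤ → ∣ i ∣ ≤ ∣ j ∣
∣⇒∣∣≤ {j = j} i∣j j≢0 =
  ℕ.∣⇒≤ {{ℕ.≢-nonZero (j≢0 ∘ ℤ.∣i∣≡0⇒i≡0)}} (∣⇒∣ᵤ i∣j)

-- Division by a linear factor, and the congruences it gives.

-- The quotient of f - f(u) by X - u, by synthetic division: for f = c + X g, one has f - f(u) = X
-- (g - g(u)) + (X - u) g(u), and the recursion handles g - g(u).
quot : Poly → ℤ → Poly
quot []       u = []
quot (c ∷ cs) u = eval cs u ∷ quot cs u

eval-quot : ∀ f u x → eval f x - eval f u ≡ (x - u) * eval (quot f u) x
eval-quot []       u x = sym (ℤ.*-zeroʳ (x - u))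
eval-quot (c ∷ cs) u x = begin
  (c + x * e) - (c + u * e′)      ≡⟨ expand c x u e e′ ⟩
  x * (e - e′) + (x - u) * e′     ≡⟨ cong (λ d → x * d + (x - u) * e′) (eval-quot cs u x) ⟩
  x * ((x - u) * q) + (x - u) * e′ ≡⟨ collect x (x - u) q e′ ⟩
  (x - u) * (e′ + x * q)          ∎
  where
  open ≡-Reasoning
  e = eval cs x
  e′ = eval cs u
  q = eval (quot cs u) x
  expand : ∀ c x u e e′ → (c + x * e) - (c + u * e′) ≡ x * (e - e′) + (x - u) * e′
  expand = solve-∀
  collect : ∀ x d q e′ → x * (d * q) + d * e′ ≡ d * (e′ + x * q)
  collect = solve-∀

eval-cong-∣ : ∀ f x y → x - y ∣ˢ eval f x - eval f y
eval-cong-∣ f x y = divides (eval (quot f y) x)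
  (trans (eval-quot f y x) (ℤ.*-comm (x - y) _))

-- f − f(u) = (X − u) q, and f(v) = f(u) with v ≠ u makes v a root of q.
collision-∣ : ∀ f {u v} → u ≢ v → eval f u ≡ eval f v →
  ∀ x → (x - u) * (x - v) ∣ˢ eval f x - eval f u
collision-∣ f {u} {v} u≢v fu≡fv x =
  subst ((x - u) * (x - v) ∣ˢ_) (sym (eval-quot f u x)) (*-monoʳ-∣ (x - u) x-v∣q[x])
  where
  q = quot f u
  q[v]≡0 : eval q v ≡ 0ℤ
  q[v]≡0 with ℤ.i*j≡0⇒i≡0∨j≡0 (v - u)
    (trans (sym (eval-quot f u v)) (ℤ.i≡j⇒i-j≡0 (sym fu≡fv)))
  ... | inj₁ v-u≡0 = contradiction v-u≡0 (≢⇒-≢0 (u≢v ∘ sym))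
  ... | inj₂ eq    = eq
  x-v∣q[x] : x - v ∣ˢ eval q x
  x-v∣q[x] = subst (x - v ∣ˢ_)
    (trans (cong (λ e → eval q x - e) q[v]≡0) (ℤ.+-identityʳ _)) (eval-cong-∣ q x v)

-- Iterates and integer cycles.

iter-+ : ∀ f m n x → iter f (m ℕ.+ n) x ≡ iter f m (iter f n x)
iter-+ f zero    n x = refl
iter-+ f (suc m) n x = cong (eval f) (iter-+ f m n x)

iter-comm : ∀ f m n x → iter f m (iter f n x) ≡ iter f n (iter f m x)
iter-comm f m n x = begin
  iter f m (iter f n x) ≡⟨ iter-+ f m n x ⟨
  iter f (m ℕ.+ n) x    ≡⟨ cong (λ k → iter f k x) (ℕ.+-comm m n) ⟩
  iter f (n ℕ.+ m) x    ≡⟨ iter-+ f n m x ⟩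
  iter f n (iter f m x) ∎
  where open ≡-Reasoning

iter-cong-∣ : ∀ f n x y → x - y ∣ˢ iter f n x - iter f n y
iter-cong-∣ f zero    x y = ∣-refl
iter-cong-∣ f (suc n) x y =
  ∣-trans (iter-cong-∣ f n x y) (eval-cong-∣ f (iter f n x) (iter f n y))

-- Along a cycle the successive differences divide each other cyclically, so
-- they agree up to sign; a sign change gives period 2, and otherwise the cycle
-- is an arithmetic progression, hence constant.
module _ (f : Poly) (y : ℤ) (q : ℕ) (y-periodic : iter f (suc q) y ≡ y) where
  private
    z : ℕ → ℤ
    z i = iter f i y

    d : ℕ → ℤ
    d i = z (suc i) - z i

    d-∣ : ∀ k i → d i ∣ˢ d (k ℕ.+ i)
    d-∣ zero    i = ∣-refl
    d-∣ (suc k) i =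
      ∣-trans (d-∣ k i) (eval-cong-∣ f (z (suc (k ℕ.+ i))) (z (k ℕ.+ i)))

    z-shift : ∀ i → z (q ℕ.+ suc i) ≡ z i
    z-shift i = begin
      z (q ℕ.+ suc i)            ≡⟨ cong z (ℕ.+-suc q i) ⟩
      z (suc q ℕ.+ i)            ≡⟨ iter-+ f (suc q) i y ⟩
      iter f (suc q) (z i)       ≡⟨ iter-comm f (suc q) i y ⟩
      iter f i (iter f (suc q) y) ≡⟨ cong (iter f i) y-periodic ⟩
      z i                        ∎
      where open ≡-Reasoning

    d-step : ∀ i → d (suc i) ≡ d i ⊎ z (2 ℕ.+ i) ≡ z i
    d-step i with ∣-antisym
      (subst (d (suc i) ∣ˢ_) (cong₂ _-_ (cong (eval f) (z-shift i)) (z-shift i)) (d-∣ q (suc i)))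
      (d-∣ 1 i)
    ... | inj₁ eq = inj₁ eq
    ... | inj₂ eq = inj₂ (begin
      z (2 ℕ.+ i)               ≡⟨ add-sub (z (2 ℕ.+ i)) (z (suc i)) ⟩
      d (suc i) + z (suc i)     ≡⟨ cong (_+ z (suc i)) eq ⟩
      - d i + z (suc i)         ≡⟨ cancel (z (suc i)) (z i) ⟩
      z i                       ∎)
      where
      open ≡-Reasoning
      add-sub : ∀ a b → a ≡ (a - b) + b
      add-sub = solve-∀
      cancel : ∀ a b → - (a - b) + a ≡ b
      cancel = solve-∀

    progression : ∀ n → (Σ ℕ λ i → z (2 ℕ.+ i) ≡ z i) ⊎ (d n ≡ d 0 × z n ≡ y + + n * d 0)
    progression zero    = inj₂ (refl , sym (ℤ.+-identityʳ y))
    progression (suc n) with progression n | d-step n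
    ... | inj₁ found      | _         = inj₁ found
    ... | inj₂ _          | inj₂ eq   = inj₁ (n , eq)
    ... | inj₂ (dₙ , zₙ) | inj₁ d-eq = inj₂ (trans d-eq dₙ , (begin
      z (suc n)                 ≡⟨ split (z (suc n)) (z n) ⟩
      z n + d n                 ≡⟨ cong₂ _+_ zₙ dₙ ⟩
      (y + + n * d 0) + d 0     ≡⟨ regroup y (+ n) (d 0) ⟩
      y + (+ 1 + + n) * d 0     ∎))
      where
      open ≡-Reasoning
      split : ∀ a b → a ≡ b + (a - b)
      split = solve-∀
      regroup : ∀ y n e → (y + n * e) + e ≡ y + (+ 1 + n) * e
      regroup = solve-∀

  periodic⇒period-two : Σ ℕ λ i → iter f (2 ℕ.+ i) y ≡ iter f i y
  periodic⇒period-two with progression (suc q)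
  ... | inj₁ found     = found
  -- Closing up after `suc q` equal steps forces the step `d 0` to vanish, so y is a fixed point and
  -- index 0 serves.
  ... | inj₂ (_ , z-eq) = 0 , trans (cong (eval f) fy≡y) fy≡y
    where
    open ≡-Reasoning
    n*d≡0 : + suc q * d 0 ≡ 0ℤ
    n*d≡0 = begin
      + suc q * d 0           ≡⟨ sub-add y (+ suc q * d 0) ⟩
      (y + + suc q * d 0) - y ≡⟨ cong (_- y) (trans (sym z-eq) y-periodic) ⟩
      y - y                   ≡⟨ ℤ.+-inverseʳ y ⟩
      0ℤ                      ∎
      where
      sub-add : ∀ a b → b ≡ (a + b) - a
      sub-add = solve-∀
    fy≡y : eval f y ≡ y
    fy≡y with ℤ.i*j≡0⇒i≡0∨j≡0 (+ suc q) n*d≡0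
    ... | inj₂ d≡0 = ℤ.i-j≡0⇒i≡j _ _ d≡0

preperiodic⇒period-two : ∀ f x → Preperiodic f x →
  Σ ℕ λ m → iter f (2 ℕ.+ m) x ≡ iter f m x
preperiodic⇒period-two f x (m , q , eq) with periodic⇒period-two f (iter f m x) q eq
... | i , eq₂ = i ℕ.+ m , (begin
  iter f (2 ℕ.+ (i ℕ.+ m)) x   ≡⟨ iter-+ f (2 ℕ.+ i) m x ⟩
  iter f (2 ℕ.+ i) (iter f m x) ≡⟨ eq₂ ⟩
  iter f i (iter f m x)        ≡⟨ iter-+ f i m x ⟨
  iter f (i ℕ.+ m) x           ∎)
  where open ≡-Reasoning

module PeriodTwo (f : Poly) (x : ℤ) (M : ℕ) (M-eq : iter f (2 ℕ.+ M) x ≡ iter f M x) where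

  period-two-from : ∀ {m} → M ≤ m → iter f (2 ℕ.+ m) x ≡ iter f m x
  period-two-from {m} M≤m = begin
    iter f (2 ℕ.+ m) x              ≡⟨ cong (λ k → iter f (2 ℕ.+ k) x) m≡ ⟩
    iter f (2 ℕ.+ (k ℕ.+ M)) x      ≡⟨ cong (λ n → iter f n x) (swap k M) ⟩
    iter f (k ℕ.+ (2 ℕ.+ M)) x      ≡⟨ iter-+ f k (2 ℕ.+ M) x ⟩
    iter f k (iter f (2 ℕ.+ M) x)   ≡⟨ cong (iter f k) M-eq ⟩
    iter f k (iter f M x)           ≡⟨ iter-+ f k M x ⟨
    iter f (k ℕ.+ M) x              ≡⟨ cong (λ k → iter f k x) m≡ ⟨
    iter f m x                      ∎
    where
    open ≡-Reasoning
    k = m ℕ.∸ M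
    m≡ : m ≡ k ℕ.+ M
    m≡ = sym (ℕ.m∸n+n≡m M≤m)
    swap : ∀ k M → 2 ℕ.+ (k ℕ.+ M) ≡ k ℕ.+ (2 ℕ.+ M)
    swap k M = sym (trans (ℕ.+-suc k (suc M)) (cong suc (ℕ.+-suc k M)))

  even-shift : ∀ h {m} → M ≤ m → iter f (h ℕ.* 2 ℕ.+ m) x ≡ iter f m x
  even-shift zero    M≤m = refl
  even-shift (suc h) M≤m =
    trans (period-two-from (ℕ.≤-trans M≤m (ℕ.m≤n+m _ (h ℕ.* 2)))) (even-shift h M≤m)

-- Divisibility along the orbit of 0.

∣-∣⇒∣ : ∀ {d i j} → d ∣ˢ i → d ∣ˢ i - j → d ∣ˢ j
∣-∣⇒∣ {d} {i} {j} d∣i d∣i-j = subst (d ∣ˢ_) (i-[i-j]≡j i j) (∣m∣n⇒∣m-n d∣i d∣i-j)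

-- The points f^k(0) and 0 differ by f^k(0), and applying f^j to both preserves divisibility of the
-- difference.
iter-shift-∣ : ∀ f k j → iter f k 0ℤ ∣ˢ iter f (k ℕ.+ j) 0ℤ - iter f j 0ℤ
iter-shift-∣ f k j = subst₂ _∣ˢ_ (ℤ.+-identityʳ _)
  (cong (λ i → i - iter f j 0ℤ)
    (trans (iter-comm f j k 0ℤ) (sym (iter-+ f k j 0ℤ))))
  (iter-cong-∣ f j (iter f k 0ℤ) 0ℤ)

-- Telescoping n shifts by k.
iter-multiple-∣ : ∀ f k n j → iter f k 0ℤ ∣ˢ iter f (n ℕ.* k ℕ.+ j) 0ℤ - iter f j 0ℤ
iter-multiple-∣ f k zero    j = subst (iter f k 0ℤ ∣ˢ_)
  (sym (ℤ.+-inverseʳ (iter f j 0ℤ))) (divides 0ℤ refl)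
iter-multiple-∣ f k (suc n) j = subst (iter f k 0ℤ ∣ˢ_)
  (telescope (iter f (k ℕ.+ n ℕ.* k ℕ.+ j) 0ℤ) (iter f (n ℕ.* k ℕ.+ j) 0ℤ) (iter f j 0ℤ))
  (∣m∣n⇒∣m+n
    (subst (λ i → iter f k 0ℤ ∣ˢ iter f i 0ℤ - iter f (n ℕ.* k ℕ.+ j) 0ℤ)
      (sym (ℕ.+-assoc k (n ℕ.* k) j)) (iter-shift-∣ f k (n ℕ.* k ℕ.+ j)))
    (iter-multiple-∣ f k n j))
  where
  telescope : ∀ a b c → (a - b) + (b - c) ≡ a - c
  telescope = solve-∀

module OrbitOfZero (f : Poly) (sp : StrictlyPreperiodic f 0ℤ) where

  b : ℕ → ℤ
  b k = iter f k 0ℤ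

  private
    M : ℕ
    M = proj₁ (preperiodic⇒period-two f 0ℤ (proj₁ sp))

  open PeriodTwo f 0ℤ M (proj₂ (preperiodic⇒period-two f 0ℤ (proj₁ sp)))

  b≢0 : ∀ k → b (suc k) ≢ 0ℤ
  b≢0 k eq = proj₂ sp (k , eq)

  b-∣-multiple : ∀ k n → b k ∣ˢ b (n ℕ.* k)
  b-∣-multiple k n = subst (b k ∣ˢ_)
    (trans (ℤ.+-identityʳ _) (cong b (ℕ.+-identityʳ (n ℕ.* k)))) (iter-multiple-∣ f k n 0)

  -- With k = 2h + r and n large, b k divides b (n k + k) = b (n k + r), which
  -- is congruent to b r modulo b k.
  b-∣-parity : ∀ h r → b (h ℕ.* 2 ℕ.+ suc r) ∣ˢ b (suc r)
  b-∣-parity h r = ∣-∣⇒∣ b[k]∣b[Mk+r] (iter-multiple-∣ f k M (suc r))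
    where
    open ≡-Reasoning
    k = h ℕ.* 2 ℕ.+ suc r
    M≤Mk : M ≤ M ℕ.* k
    M≤Mk = subst (λ i → M ≤ M ℕ.* i) (sym (ℕ.+-suc (h ℕ.* 2) r)) (ℕ.m≤m*n M (suc (h ℕ.* 2 ℕ.+ r)))
    rearrange : ∀ m k h r → k ≡ h ℕ.+ r → k ℕ.+ m ≡ h ℕ.+ (m ℕ.+ r)
    rearrange m k h r refl = trans (ℕ.+-assoc h r m) (cong (h ℕ.+_) (ℕ.+-comm r m))
    b[k]∣b[Mk+r] : b k ∣ˢ b (M ℕ.* k ℕ.+ suc r)
    b[k]∣b[Mk+r] = subst (b k ∣ˢ_)
      (trans (cong b (rearrange (M ℕ.* k) k (h ℕ.* 2) (suc r) refl))
             (even-shift h (ℕ.≤-trans M≤Mk (ℕ.m≤m+n _ _))))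
      (b-∣-multiple k (suc M))

  b₁∣ell : b 1 ∣ˢ ell f
  b₁∣ell = ∣ᵤ⇒∣ {i = ell f} (ℤ.i∣lcm[i,j] (b 1) (b 2))

  b₂∣ell : b 2 ∣ˢ ell f
  b₂∣ell = ∣ᵤ⇒∣ {i = ell f} (ℤ.j∣lcm[i,j] (b 1) (b 2))

  odd⊎even : ∀ k → Σ ℕ λ h → suc k ≡ h ℕ.* 2 ℕ.+ 1 ⊎ suc k ≡ h ℕ.* 2 ℕ.+ 2
  odd⊎even zero = 0 , inj₁ refl
  odd⊎even (suc k) with odd⊎even k
  ... | h , inj₁ eq = h , inj₂ (trans (cong suc eq) (sym (ℕ.+-suc (h ℕ.* 2) 1)))
  ... | h , inj₂ eq = suc h , inj₁ (cong suc (trans eq (ℕ.+-suc (h ℕ.* 2) 1)))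

  b∣ell : ∀ k → b (suc k) ∣ˢ ell f
  b∣ell k with odd⊎even k
  ... | h , inj₁ eq = ∣-trans (subst (λ i → b i ∣ˢ b 1) (sym eq) (b-∣-parity h 0)) b₁∣ell
  ... | h , inj₂ eq = ∣-trans (subst (λ i → b i ∣ˢ b 2) (sym eq) (b-∣-parity h 1)) b₂∣ell

  b₁∣b₂ : b 1 ∣ˢ b 2
  b₁∣b₂ = b-∣-multiple 1 2

  ell∣b₂ : ell f ∣ˢ b 2
  ell∣b₂ = ∣ᵤ⇒∣ (ℤ.lcm-least {b 1} {b 2} {b 2} (∣⇒∣ᵤ b₁∣b₂) ℕ.∣-refl)

  ell≢0 : ell f ≢ 0ℤ
  ell≢0 eq = b≢0 1 (0∣⇒≡0 (subst (_∣ˢ b 2) eq ell∣b₂))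

  -- 3 and 1 have the same parity, so `b 3` divides `b 1`; conversely `b 1` divides every `b n`.
  b₃≡±b₁ : b 3 ≡ b 1 ⊎ b 3 ≡ - b 1
  b₃≡±b₁ = ∣-antisym (b-∣-parity 1 0) (b-∣-multiple 1 3)

  b₄≡±b₂ : b 4 ≡ b 2 ⊎ b 4 ≡ - b 2
  b₄≡±b₂ = ∣-antisym (b-∣-parity 1 1) (b-∣-multiple 2 2)

  module _ (x₀ : ℤ) (wandering : Wandering f x₀) where

    -- A term shared with the orbit of 0 would pass the eventual period two of that orbit on to x₀,
    -- making two terms of the wandering orbit coincide.
    wandering-avoids : ∀ n k → iter f n x₀ ≢ b k
    wandering-avoids n k eq =
      wandering (2 ℕ.+ (M ℕ.+ n)) (M ℕ.+ n) (ℕ.m+1+n≢m _ ∘ trans (ℕ.+-comm _ 2)) (begin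
        iter f (2 ℕ.+ (M ℕ.+ n)) x₀        ≡⟨ iter-+ f (2 ℕ.+ M) n x₀ ⟩
        iter f (2 ℕ.+ M) (iter f n x₀)     ≡⟨ cong (iter f (2 ℕ.+ M)) eq ⟩
        iter f (2 ℕ.+ M) (b k)             ≡⟨ iter-+ f (2 ℕ.+ M) k 0ℤ ⟨
        b (2 ℕ.+ (M ℕ.+ k))                ≡⟨ period-two-from (ℕ.m≤m+n M k) ⟩
        b (M ℕ.+ k)                        ≡⟨ iter-+ f M k 0ℤ ⟩
        iter f M (b k)                     ≡⟨ cong (iter f M) eq ⟨
        iter f M (iter f n x₀)             ≡⟨ iter-+ f M n x₀ ⟨
        iter f (M ℕ.+ n) x₀                ∎)
      where open ≡-Reasoning

  common-divisor-∣-ell : ∀ x₀ {d} m k → d ∣ˢ iter f m x₀ → d ∣ˢ iter f (suc k ℕ.+ m) x₀ → d ∣ˢ ell f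
  common-divisor-∣-ell x₀ {d} m k d∣xₘ d∣xₙ =
    ∣-trans (∣-∣⇒∣ d∣xₙ (∣-trans d∣xₘ xₘ∣)) (b∣ell k)
    where
    xₘ∣ : iter f m x₀ ∣ˢ iter f (suc k ℕ.+ m) x₀ - b (suc k)
    xₘ∣ = subst₂ _∣ˢ_ (ℤ.+-identityʳ _)
      (cong (λ i → i - b (suc k)) (sym (iter-+ f (suc k) m x₀)))
      (iter-cong-∣ f (suc k) (iter f m x₀) 0ℤ)

-- Exact division by the gcd, and coprimality of the quotients.

-- If x = a g, ℓ = l g, y = b h and ℓ = k h with g = gcd x ℓ and h = gcd y ℓ, a
-- common divisor d of a and b makes d · gcd g h divide ℓ, which divides
-- gcd g h · l · k; but d is coprime to l and k.
gcd-cofactors-coprime : ∀ {x y ℓ a b} → ℓ ≢ 0 →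
  (∀ {d} → d ℕ.∣ x → d ℕ.∣ y → d ℕ.∣ ℓ) →
  a ℕ.* ℕ.gcd x ℓ ≡ x → b ℕ.* ℕ.gcd y ℓ ≡ y → ℕ.Coprime a b
gcd-cofactors-coprime {x} {y} {ℓ} {a} {b} ℓ≢0 common x≡ y≡ {d} (d∣a , d∣b)
  with ℕ.gcd[m,n]∣n x ℓ | ℕ.gcd[m,n]∣n y ℓ
... | ℕ.divides l ℓ≡lg | ℕ.divides k ℓ≡kh =
  cofactors-coprime y k y≡ ℓ≡kh (d∣b , ℕ.coprime-divisor d-l-coprime d∣lk)
  where
  g = ℕ.gcd x ℓ
  h = ℕ.gcd y ℓ
  q = ℕ.gcd g h
  -- If e divides both cofactors, then e times the gcd divides x and ℓ, hence divides the gcd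
  -- itself.
  cofactors-coprime : ∀ x l {a} → a ℕ.* ℕ.gcd x ℓ ≡ x → ℓ ≡ l ℕ.* ℕ.gcd x ℓ → ℕ.Coprime a l
  cofactors-coprime x l {a} x≡ ℓ≡ {e} (e∣a , e∣l) = ℕ.∣1⇒≡1
    (ℕ.*-cancelʳ-∣ (ℕ.gcd x ℓ) {{ℕ.≢-nonZero (ℓ≢0 ∘ ℕ.gcd[m,n]≡0⇒n≡0 x)}}
      (subst (e ℕ.* ℕ.gcd x ℓ ℕ.∣_) (sym (ℕ.*-identityˡ _))
        (ℕ.gcd-greatest
          (subst (e ℕ.* ℕ.gcd x ℓ ℕ.∣_) x≡ (ℕ.*-monoˡ-∣ (ℕ.gcd x ℓ) e∣a))
          (subst (e ℕ.* ℕ.gcd x ℓ ℕ.∣_) (sym ℓ≡) (ℕ.*-monoˡ-∣ (ℕ.gcd x ℓ) e∣l)))))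
  d-l-coprime : ℕ.Coprime d l
  d-l-coprime (e∣d , e∣l) = cofactors-coprime x l x≡ ℓ≡lg (ℕ.∣-trans e∣d d∣a , e∣l)
  dq∣ℓ : d ℕ.* q ℕ.∣ ℓ
  dq∣ℓ = common
    (subst (d ℕ.* q ℕ.∣_) x≡ (ℕ.*-pres-∣ d∣a (ℕ.gcd[m,n]∣m g h)))
    (subst (d ℕ.* q ℕ.∣_) y≡ (ℕ.*-pres-∣ d∣b (ℕ.gcd[m,n]∣n g h)))
  dq∣lkg : d ℕ.* q ℕ.∣ (l ℕ.* k) ℕ.* g
  dq∣lkg = ℕ.∣-trans dq∣ℓ (ℕ.divides k (trans (swap l k g) (cong (k ℕ.*_) (sym ℓ≡lg))))
    where
    swap : ∀ l k g → (l ℕ.* k) ℕ.* g ≡ k ℕ.* (l ℕ.* g)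
    swap = ℕ-solver.solve-∀
  dq∣lkh : d ℕ.* q ℕ.∣ (l ℕ.* k) ℕ.* h
  dq∣lkh = ℕ.∣-trans dq∣ℓ
    (ℕ.divides l (trans (ℕ.*-assoc l k h) (cong (l ℕ.*_) (sym ℓ≡kh))))
  -- d q divides l k g and l k h, hence their gcd l k q; and q is nonzero because ℓ is.
  d∣lk : d ℕ.∣ l ℕ.* k
  d∣lk = ℕ.*-cancelʳ-∣ q
    {{ℕ.≢-nonZero (ℓ≢0 ∘ ℕ.gcd[m,n]≡0⇒n≡0 x ∘ ℕ.gcd[m,n]≡0⇒m≡0)}}
    (subst (d ℕ.* q ℕ.∣_) (sym (ℕ.c*gcd[m,n]≡gcd[cm,cn] (l ℕ.* k) g h))
      (ℕ.gcd-greatest dq∣lkg dq∣lkh))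

-- The remainder is a difference of two multiples of the divisor and is smaller than it, so it is 0.
divBy-exact : ∀ x k → k ≢ 0 → k ℕ.∣ ∣ x ∣ → divBy x k * + k ≡ x
divBy-exact x zero    k≢0 _   = contradiction refl k≢0
divBy-exact x (suc k) _   k∣x = begin
  (x /ℕ suc k) * + suc k                        ≡⟨ ℤ.+-identityˡ _ ⟨
  0ℤ + (x /ℕ suc k) * + suc k                   ≡⟨ cong (λ r → + r + (x /ℕ suc k) * + suc k) r≡0 ⟨
  + (x %ℕ suc k) + (x /ℕ suc k) * + suc k       ≡⟨ ℤ.a≡a%ℕn+[a/ℕn]*n x (suc k) ⟨
  x                                             ∎
  where
  open ≡-Reasoning
  r = x %ℕ suc k
  k∣r : suc k ℕ.∣ r
  k∣r = ∣⇒∣ᵤ (∣-∣⇒∣ {i = (x /ℕ suc k) * + suc k + + r}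
    (subst (+ suc k ∣ˢ_)
      (trans (ℤ.a≡a%ℕn+[a/ℕn]*n x (suc k)) (ℤ.+-comm (+ r) ((x /ℕ suc k) * + suc k)))
      (∣ᵤ⇒∣ k∣x))
    (divides (x /ℕ suc k) (add-sub ((x /ℕ suc k) * + suc k) (+ r))))
    where
    add-sub : ∀ a b → a + b - b ≡ a
    add-sub = solve-∀
  r≡0 : r ≡ 0
  r≡0 with r ℕ.≟ 0
  ... | yes eq  = eq
  ... | no  r≢0 = contradiction (ℕ.∣⇒≤ {{ℕ.≢-nonZero r≢0}} k∣r) (ℕ.<⇒≱ (ℤ.n%ℕd<d x (suc k)))

∣aSeq∣*gcd : ∀ f x₀ n → ell f ≢ 0ℤ →
  ∣ aSeq f x₀ n ∣ ℕ.* ℕ.gcd ∣ iter f n x₀ ∣ ∣ ell f ∣ ≡ ∣ iter f n x₀ ∣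
∣aSeq∣*gcd f x₀ n ell≢0 = trans (sym (ℤ.abs-* (aSeq f x₀ n) (+ g)))
  (cong ∣_∣ (divBy-exact (iter f n x₀) g
    (ell≢0 ∘ ℤ.∣i∣≡0⇒i≡0 ∘ ℕ.gcd[m,n]≡0⇒n≡0 ∣ iter f n x₀ ∣)
    (ℕ.gcd[m,n]∣m ∣ iter f n x₀ ∣ ∣ ell f ∣)))
  where g = ℕ.gcd ∣ iter f n x₀ ∣ ∣ ell f ∣

-- If the quotient is a unit, |x_n| is the gcd itself. Read contrapositively, this reduces the
-- existence of a prime factor of a_n to showing that x_n does not divide ℓ.
unit-aSeq⇒∣ell : ∀ f x₀ n → ell f ≢ 0ℤ → ∣ aSeq f x₀ n ∣ ≡ 1 → iter f n x₀ ∣ˢ ell f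
unit-aSeq⇒∣ell f x₀ n ell≢0 a≡1 = ∣ᵤ⇒∣ (subst (ℕ._∣ ∣ ell f ∣)
  (trans (sym (ℕ.*-identityˡ _)) (trans (cong (ℕ._* g) (sym a≡1)) (∣aSeq∣*gcd f x₀ n ell≢0)))
  (ℕ.gcd[m,n]∣n ∣ iter f n x₀ ∣ ∣ ell f ∣))
  where g = ℕ.gcd ∣ iter f n x₀ ∣ ∣ ell f ∣

aSeq-coprime : ∀ f → StrictlyPreperiodic f 0ℤ → ∀ x₀ m n → m ≢ n →
  ℕ.Coprime ∣ aSeq f x₀ m ∣ ∣ aSeq f x₀ n ∣
aSeq-coprime f sp x₀ m n m≢n = gcd-cofactors-coprime (ell≢0 ∘ ℤ.∣i∣≡0⇒i≡0) common
  (∣aSeq∣*gcd f x₀ m ell≢0) (∣aSeq∣*gcd f x₀ n ell≢0)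
  where
  open OrbitOfZero f sp
  ordered : ∀ {d m n} → m ℕ.< n → d ℕ.∣ ∣ iter f m x₀ ∣ → d ℕ.∣ ∣ iter f n x₀ ∣ → d ℕ.∣ ∣ ell f ∣
  ordered {d} {m} {n} m<n d∣xₘ d∣xₙ = ∣⇒∣ᵤ (common-divisor-∣-ell x₀ m k (∣ᵤ⇒∣ {+ d} d∣xₘ)
    (∣ᵤ⇒∣ (subst (λ i → d ℕ.∣ ∣ iter f i x₀ ∣) n≡ d∣xₙ)))
    where
    k = n ℕ.∸ suc m
    n≡ : n ≡ suc k ℕ.+ m
    n≡ = trans (sym (ℕ.m∸n+n≡m m<n)) (ℕ.+-suc k m)
  common : ∀ {d} → d ℕ.∣ ∣ iter f m x₀ ∣ → d ℕ.∣ ∣ iter f n x₀ ∣ → d ℕ.∣ ∣ ell f ∣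
  common d∣xₘ d∣xₙ with ℕ.<-cmp m n
  ... | tri< m<n _ _ = ordered m<n d∣xₘ d∣xₙ
  ... | tri≈ _ m≡n _ = contradiction m≡n m≢n
  ... | tri> _ _ n<m = ordered n<m d∣xₙ d∣xₘ

≢1⇒prime-divisor : ∀ n → n ≢ 1 → Σ ℕ λ p → Prime p × p ℕ.∣ n
-- Every prime divides 0; 2 is an arbitrary choice.
≢1⇒prime-divisor zero        _   = 2 , prime[2] , 2 ℕ.∣0
≢1⇒prime-divisor n@(suc _) n≢1 with factorise n
... | record { factors = []     ; isFactorisation = n≡1 } = contradiction n≡1 n≢1
... | record { factors = p ∷ ps ; isFactorisation = n≡ ; factorsPrime = p-prime ∷ _ } =
  p , p-prime , subst (p ℕ.∣_) (sym n≡) (ℕ.m∣m*n _)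

-- Finite search for backward chains.

allBounded? : ∀ {P : ℤ → Set} → (∀ i → Dec (P i)) → ∀ n → Dec (∀ i → ∣ i ∣ ≤ n → P i)
allBounded? {P} P? n = map′ to from
  (ℕ.allUpTo? (λ k → P? (+ k) ×-dec P? (- + k)) (suc n))
  where
  to : (∀ {k} → k ℕ.< suc n → P (+ k) × P (- + k)) → ∀ i → ∣ i ∣ ≤ n → P i
  to h (+ k)    k≤n = proj₁ (h (s≤s k≤n))
  to h -[1+ k ] k<n = proj₂ (h (s≤s k<n))
  from : (∀ i → ∣ i ∣ ≤ n → P i) → ∀ {k} → k ℕ.< suc n → P (+ k) × P (- + k)
  from h {k} (s≤s k≤n) = h (+ k) k≤n , h (- + k) (subst (_≤ n) (sym (ℤ.∣-i∣≡∣i∣ (+ k))) k≤n)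

-- The constraints on z = f y when f u = f v = w, f s = t, and y is neither a
-- fixed point nor in {u, v, w}.
module Predecessors (u v w s t : ℤ) where

  Link : ℤ → ℤ → Set
  Link y z = (y ≢ u × y ≢ v × y ≢ w × y ≢ z) × ((y - u) * (y - v) ∣ˢ z - w) × (y - s ∣ˢ z - t)

  link? : ∀ y z → Dec (Link y z)
  link? y z = (¬? (y ≟ u) ×-dec ¬? (y ≟ v) ×-dec ¬? (y ≟ w) ×-dec ¬? (y ≟ z))
    ×-dec ((y - u) * (y - v) ∣ˢ? z - w) ×-dec (y - s ∣ˢ? z - t)

  -- Excludes chains of k `Link`s ending in z; the base case is ⊥ because the empty chain always
  -- exists. The bound on y makes the predicate decidable, and by `link-bound` it misses no
  -- predecessor of z when z ≠ w.
  NoAncestor : ℕ → ℤ → Set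
  NoAncestor zero    z = ⊥
  NoAncestor (suc k) z = ∀ y → ∣ y ∣ ≤ ∣ u ∣ ℕ.+ (∣ z ∣ ℕ.+ ∣ w ∣) → Link y z → NoAncestor k y

  noAncestor? : ∀ k z → Dec (NoAncestor k z)
  noAncestor? zero    z = no λ ()
  noAncestor? (suc k) z = allBounded? (λ y → link? y z →-dec noAncestor? k y) _

  -- y - u divides the nonzero number z - w, so it is no larger in absolute value.
  link-bound : ∀ {y z} → z ≢ w → Link y z → ∣ y ∣ ≤ ∣ u ∣ ℕ.+ (∣ z ∣ ℕ.+ ∣ w ∣)
  link-bound {y} {z} z≢w ((_ , y≢v , _) , div , _) = begin
    ∣ y ∣                                ≡⟨ cong ∣_∣ (add-sub u y) ⟩
    ∣ u + (y - u) ∣                      ≤⟨ ℤ.∣i+j∣≤∣i∣+∣j∣ u (y - u) ⟩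
    ∣ u ∣ ℕ.+ ∣ y - u ∣                  ≤⟨ ℕ.+-monoʳ-≤ ∣ u ∣ (∣⇒∣∣≤ (∣-trans (∣m⇒∣m*n {y - u} (y - v) ∣-refl) div) (≢⇒-≢0 z≢w)) ⟩
    ∣ u ∣ ℕ.+ ∣ z - w ∣                  ≤⟨ ℕ.+-monoʳ-≤ ∣ u ∣ (ℤ.∣i-j∣≤∣i∣+∣j∣ z w) ⟩
    ∣ u ∣ ℕ.+ (∣ z ∣ ℕ.+ ∣ w ∣)          ∎
    where
    open ℕ.≤-Reasoning
    add-sub : ∀ u y → y ≡ u + (y - u)
    add-sub = solve-∀

  -- Each middle term differs from w by the `Link` that starts there, which is what `link-bound`
  -- asks for the `Link` that ends there; only the last term needs a separate hypothesis.
  no-three-links : ∀ {y₀ y₁ y₂ y₃} → NoAncestor 3 y₃ → y₃ ≢ w →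
    Link y₀ y₁ → Link y₁ y₂ → Link y₂ y₃ → ⊥
  no-three-links none y₃≢w l₀ l₁@((_ , _ , y₁≢w , _) , _) l₂@((_ , _ , y₂≢w , _) , _) =
    none _ (link-bound y₃≢w l₂) l₂ _ (link-bound y₂≢w l₁) l₁ _ (link-bound y₁≢w l₀) l₀

open Predecessors using (NoAncestor; noAncestor?)

-- The sign is that of f³(0) = ± f(0); the arguments are f²(0), f(0) and a term z
-- of the wandering orbit for ₊, and f(0), f²(0) and z for ₋.
NoThreeStep₊ : ℤ → ℤ → ℤ → Set
NoThreeStep₊ c a z = c ≢ 0ℤ → c ≡ a ⊎ ∣ a ∣ ≡ 1 → z ∣ˢ c → z ≢ c → z ≢ a →
  NoAncestor 0ℤ c a a c 3 z

-- The 6 is the bound of `fixed-bound`; it passes from c to a and z because both divide c in the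
-- application.
noThreeStep₊ : ∀ c → ∣ c ∣ ≤ 6 → ∀ a → ∣ a ∣ ≤ 6 → ∀ z → ∣ z ∣ ≤ 6 → NoThreeStep₊ c a z
noThreeStep₊ = toWitness {a? = allBounded? (λ c → allBounded? (λ a → allBounded? (dec c a) 6) 6) 6} tt
  where
  dec : ∀ c a z → Dec (NoThreeStep₊ c a z)
  dec c a z = ¬? (c ≟ 0ℤ) →-dec ((c ≟ a) ⊎-dec (∣ a ∣ ℕ.≟ 1)) →-dec (z ∣ˢ? c) →-dec
    ¬? (z ≟ c) →-dec ¬? (z ≟ a) →-dec noAncestor? 0ℤ c a a c 3 z

NoThreeStep₋ : ℤ → ℤ → ℤ → Set
NoThreeStep₋ a b z = a ≢ 0ℤ → b ≢ 0ℤ → b ≢ a → a * a ∣ˢ a - b → b - a ∣ˢ b + a →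
  (b - a) * (b + a) ∣ˢ b + a → z ∣ˢ b → z ≢ a → z ≢ - a → z ≢ b →
  NoAncestor a (- a) b 0ℤ a 3 z

-- The bounds come from two of the divisibilities: b - a divides (b + a) - (b - a) = 2a, so a² ≤ |a
-- - b| ≤ 2|a|. This gives |a| ≤ 2, then |b| ≤ 3|a| ≤ 6, and z divides b.
noThreeStep₋ : ∀ a → ∣ a ∣ ≤ 2 → ∀ b → ∣ b ∣ ≤ 6 → ∀ z → ∣ z ∣ ≤ 6 → NoThreeStep₋ a b z
noThreeStep₋ = toWitness {a? = allBounded? (λ a → allBounded? (λ b → allBounded? (dec a b) 6) 6) 2} tt
  where
  dec : ∀ a b z → Dec (NoThreeStep₋ a b z)
  dec a b z = ¬? (a ≟ 0ℤ) →-dec ¬? (b ≟ 0ℤ) →-dec ¬? (b ≟ a) →-dec (a * a ∣ˢ? a - b) →-dec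
    (b - a ∣ˢ? b + a) →-dec ((b - a) * (b + a) ∣ˢ? b + a) →-dec (z ∣ˢ? b) →-dec
    ¬? (z ≟ a) →-dec ¬? (z ≟ - a) →-dec ¬? (z ≟ b) →-dec noAncestor? a (- a) b 0ℤ a 3 z

-- Size bounds when f³(0) = f(0).

≢0⇒1≤∣∣ : ∀ {i} → i ≢ 0ℤ → 1 ≤ ∣ i ∣
≢0⇒1≤∣∣ i≢0 = ℕ.n≢0⇒n>0 (i≢0 ∘ ℤ.∣i∣≡0⇒i≡0)

-- This is (m - 1)(n - 1) ≥ 0.
m+n≤1+m*n : ∀ {m n} → 1 ≤ m → 1 ≤ n → m ℕ.+ n ≤ 1 ℕ.+ m ℕ.* n
m+n≤1+m*n {suc m} {suc n} _ _ = begin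
  suc m ℕ.+ suc n                        ≤⟨ ℕ.m≤m+n _ (m ℕ.* n) ⟩
  suc m ℕ.+ suc n ℕ.+ m ℕ.* n            ≡⟨ expand m n ⟩
  1 ℕ.+ suc m ℕ.* suc n                  ∎
  where
  open ℕ.≤-Reasoning
  expand : ∀ m n → suc m ℕ.+ suc n ℕ.+ m ℕ.* n ≡ 1 ℕ.+ suc m ℕ.* suc n
  expand = ℕ-solver.solve-∀

∣j∣≤∣i∣+∣i-j∣ : ∀ i j → ∣ j ∣ ≤ ∣ i ∣ ℕ.+ ∣ i - j ∣
∣j∣≤∣i∣+∣i-j∣ i j = subst (λ k → ∣ k ∣ ≤ ∣ i ∣ ℕ.+ ∣ i - j ∣) (i-[i-j]≡j i j) (ℤ.∣i-j∣≤∣i∣+∣j∣ i (i - j))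

∣c∣≤1+∣y∣*∣y-c∣ : ∀ {y c} → y ≢ 0ℤ → y ≢ c → ∣ c ∣ ≤ 1 ℕ.+ ∣ y ∣ ℕ.* ∣ y - c ∣
∣c∣≤1+∣y∣*∣y-c∣ {y} {c} y≢0 y≢c =
  ℕ.≤-trans (∣j∣≤∣i∣+∣i-j∣ y c) (m+n≤1+m*n (≢0⇒1≤∣∣ y≢0) (≢0⇒1≤∣∣ (≢⇒-≢0 y≢c)))

open Predecessors using (Link)

-- Both bounds chain the divisibilities backwards, so that y₀ (y₀ − c), which is
-- at least |c| − 1 in absolute value, and y₂ (also y₁, if a = c) divide y₃ − a.
module _ {c a y₀ y₁ y₂ y₃ : ℤ}
  (l₀ : Link 0ℤ c a a c y₀ y₁) (l₁ : Link 0ℤ c a a c y₁ y₂) (l₂ : Link 0ℤ c a a c y₂ y₃)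
  (y₃≢a : y₃ ≢ a) (∣y₃∣≤∣c∣ : ∣ y₃ ∣ ≤ ∣ c ∣) where
  private
    N₀ = ∣ y₀ ∣ ℕ.* ∣ y₀ - c ∣

    link-∣ : ∀ {y z} → Link 0ℤ c a a c y z → ∣ y ∣ ℕ.* ∣ y - c ∣ ℕ.∣ ∣ z - a ∣
    link-∣ {y} {z} (_ , div , _) = subst (ℕ._∣ ∣ z - a ∣)
      (trans (ℤ.abs-* (y - 0ℤ) (y - c)) (cong (λ i → ∣ i ∣ ℕ.* ∣ y - c ∣) (ℤ.+-identityʳ y)))
      (∣⇒∣ᵤ div)

    ∣c∣≤1+ : ∀ {y z} → Link 0ℤ c a a c y z → ∣ c ∣ ≤ 1 ℕ.+ ∣ y ∣ ℕ.* ∣ y - c ∣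
    ∣c∣≤1+ ((y≢0 , y≢c , _) , _) = ∣c∣≤1+∣y∣*∣y-c∣ y≢0 y≢c

    ∣y₃-a∣≤ : ∣ y₃ - a ∣ ≤ ∣ c ∣ ℕ.+ ∣ a ∣
    ∣y₃-a∣≤ = ℕ.≤-trans (ℤ.∣i-j∣≤∣i∣+∣j∣ y₃ a) (ℕ.+-monoˡ-≤ ∣ a ∣ ∣y₃∣≤∣c∣)

    ≤∣-a∣ : ∀ {d y} → y ≢ a → d ℕ.∣ ∣ y - a ∣ → d ≤ ∣ y - a ∣
    ≤∣-a∣ y≢a = ℕ.∣⇒≤ {{ℕ.≢-nonZero (≢⇒-≢0 y≢a ∘ ℤ.∣i∣≡0⇒i≡0)}}

    y₁≢a : y₁ ≢ a
    y₁≢a = proj₁ (proj₂ (proj₂ (proj₁ l₁)))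

    y₂≢a : y₂ ≢ a
    y₂≢a = proj₁ (proj₂ (proj₂ (proj₁ l₂)))

  -- If |y₂| ≤ 1, then |c| - 1 ≤ |y₁ (y₁ - c)| ≤ |y₂ - a| ≤ 2. Otherwise `N₀` divides y₁ - a, which
  -- divides y₂ - c, so y₂ `N₀` divides y₃ - a and 2 `N₀` ≤ |c| + 1 ≤ `N₀` + 2.
  unit-bound : ∣ a ∣ ≡ 1 → ∣ c ∣ ≤ 3
  unit-bound ∣a∣≡1 with ∣ y₂ ∣ ℕ.≤? 1
  ... | yes ∣y₂∣≤1 = begin
    ∣ c ∣                              ≤⟨ ∣c∣≤1+ l₁ ⟩
    1 ℕ.+ ∣ y₁ ∣ ℕ.* ∣ y₁ - c ∣        ≤⟨ s≤s (≤∣-a∣ y₂≢a (link-∣ l₁)) ⟩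
    1 ℕ.+ ∣ y₂ - a ∣                   ≤⟨ s≤s (ℤ.∣i-j∣≤∣i∣+∣j∣ y₂ a) ⟩
    1 ℕ.+ (∣ y₂ ∣ ℕ.+ ∣ a ∣)           ≤⟨ s≤s (ℕ.+-mono-≤ ∣y₂∣≤1 (ℕ.≤-reflexive ∣a∣≡1)) ⟩
    3                                  ∎
    where open ℕ.≤-Reasoning
  ... | no ∣y₂∣≰1 = ℕ.≤-trans (∣c∣≤1+ l₀) (s≤s N₀≤2)
    where
    open ℕ.≤-Reasoning
    N₀∣y₂-c : N₀ ℕ.∣ ∣ y₂ - c ∣
    N₀∣y₂-c = ℕ.∣-trans (link-∣ l₀) (∣⇒∣ᵤ (proj₂ (proj₂ l₁)))
    N₀≤2 : N₀ ≤ 2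
    N₀≤2 = ℕ.+-cancelʳ-≤ N₀ N₀ 2 (begin
      N₀ ℕ.+ N₀                ≡⟨ cong (N₀ ℕ.+_) (ℕ.+-identityʳ N₀) ⟨
      2 ℕ.* N₀                 ≤⟨ ℕ.*-monoˡ-≤ N₀ (ℕ.≰⇒> ∣y₂∣≰1) ⟩
      ∣ y₂ ∣ ℕ.* N₀            ≤⟨ ≤∣-a∣ y₃≢a (ℕ.∣-trans (ℕ.*-monoʳ-∣ ∣ y₂ ∣ N₀∣y₂-c) (link-∣ l₂)) ⟩
      ∣ y₃ - a ∣               ≤⟨ ∣y₃-a∣≤ ⟩
      ∣ c ∣ ℕ.+ ∣ a ∣          ≡⟨ cong (∣ c ∣ ℕ.+_) ∣a∣≡1 ⟩
      ∣ c ∣ ℕ.+ 1              ≤⟨ ℕ.+-monoˡ-≤ 1 (∣c∣≤1+ l₀) ⟩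
      1 ℕ.+ N₀ ℕ.+ 1           ≡⟨ cong suc (ℕ.+-comm N₀ 1) ⟩
      2 ℕ.+ N₀                 ∎)

  -- If |y₂ y₁| ≤ 2, both factors are at most 2 in absolute value, and y₁ - c divides y₂ - c, hence
  -- y₂ - y₁, which bounds c. Otherwise the three divisibilities chain to y₂ y₁ `N₀` dividing y₃ -
  -- c, so 3 `N₀` ≤ 2|c| ≤ 2 `N₀` + 2.
  fixed-bound : c ≡ a → ∣ c ∣ ≤ 6
  fixed-bound refl with ∣ y₂ ∣ ℕ.* ∣ y₁ ∣ ℕ.≤? 2
  ... | yes small = begin
    ∣ c ∣                              ≤⟨ ∣j∣≤∣i∣+∣i-j∣ y₁ c ⟩
    ∣ y₁ ∣ ℕ.+ ∣ y₁ - c ∣              ≤⟨ ℕ.+-monoʳ-≤ ∣ y₁ ∣ (∣⇒∣∣≤ y₁-c∣y₂-y₁ (≢⇒-≢0 (y₁≢y₂ ∘ sym))) ⟩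
    ∣ y₁ ∣ ℕ.+ ∣ y₂ - y₁ ∣             ≤⟨ ℕ.+-monoʳ-≤ ∣ y₁ ∣ (ℤ.∣i-j∣≤∣i∣+∣j∣ y₂ y₁) ⟩
    ∣ y₁ ∣ ℕ.+ (∣ y₂ ∣ ℕ.+ ∣ y₁ ∣)     ≤⟨ ℕ.+-mono-≤ ∣y₁∣≤2 (ℕ.+-mono-≤ ∣y₂∣≤2 ∣y₁∣≤2) ⟩
    6                                  ∎
    where
    open ℕ.≤-Reasoning
    y₁≢y₂ : y₁ ≢ y₂
    y₁≢y₂ = proj₂ (proj₂ (proj₂ (proj₁ l₁)))
    ∣y₁∣≤2 : ∣ y₁ ∣ ≤ 2
    ∣y₁∣≤2 = ℕ.≤-trans
      (ℕ.m≤n*m ∣ y₁ ∣ ∣ y₂ ∣ {{ℕ.≢-nonZero (proj₁ (proj₁ l₂) ∘ ℤ.∣i∣≡0⇒i≡0)}}) small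
    ∣y₂∣≤2 : ∣ y₂ ∣ ≤ 2
    ∣y₂∣≤2 = ℕ.≤-trans
      (ℕ.m≤m*n ∣ y₂ ∣ ∣ y₁ ∣ {{ℕ.≢-nonZero (proj₁ (proj₁ l₁) ∘ ℤ.∣i∣≡0⇒i≡0)}}) small
    y₁-c∣y₂-y₁ : y₁ - c ∣ˢ y₂ - y₁
    y₁-c∣y₂-y₁ = subst (y₁ - c ∣ˢ_) (cancel y₂ y₁ c) (∣m∣n⇒∣m-n (proj₂ (proj₂ l₁)) ∣-refl)
      where
      cancel : ∀ i j k → (i - k) - (j - k) ≡ i - j
      cancel = solve-∀
  ... | no large = ℕ.≤-trans (∣c∣≤1+ l₀) (s≤s (ℕ.≤-trans N₀≤2 (s≤s (s≤s z≤n))))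
    where
    open ℕ.≤-Reasoning
    div : (∣ y₂ ∣ ℕ.* ∣ y₁ ∣) ℕ.* N₀ ℕ.∣ ∣ y₃ - c ∣
    div = ℕ.∣-trans (ℕ.∣-reflexive (ℕ.*-assoc ∣ y₂ ∣ ∣ y₁ ∣ N₀))
      (ℕ.∣-trans (ℕ.*-monoʳ-∣ ∣ y₂ ∣ (ℕ.∣-trans (ℕ.*-monoʳ-∣ ∣ y₁ ∣ (link-∣ l₀)) (link-∣ l₁)))
        (link-∣ l₂))
    N₀≤2 : N₀ ≤ 2
    N₀≤2 = ℕ.+-cancelʳ-≤ (N₀ ℕ.+ N₀) N₀ 2 (begin
      N₀ ℕ.+ (N₀ ℕ.+ N₀)                ≡⟨ cong (λ i → N₀ ℕ.+ (N₀ ℕ.+ i)) (ℕ.+-identityʳ N₀) ⟨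
      3 ℕ.* N₀                          ≤⟨ ℕ.*-monoˡ-≤ N₀ (ℕ.≰⇒> large) ⟩
      (∣ y₂ ∣ ℕ.* ∣ y₁ ∣) ℕ.* N₀        ≤⟨ ≤∣-a∣ y₃≢a div ⟩
      ∣ y₃ - c ∣                        ≤⟨ ∣y₃-a∣≤ ⟩
      ∣ c ∣ ℕ.+ ∣ c ∣                   ≤⟨ ℕ.+-mono-≤ (∣c∣≤1+ l₀) (∣c∣≤1+ l₀) ⟩
      suc N₀ ℕ.+ suc N₀                 ≡⟨ cong suc (ℕ.+-suc N₀ N₀) ⟩
      2 ℕ.+ (N₀ ℕ.+ N₀)                 ∎)

-- Terms from index 3 on do not divide ℓ.

i+i≡0⇒i≡0 : ∀ {i} → i + i ≡ 0ℤ → i ≡ 0ℤ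
i+i≡0⇒i≡0 {i} eq with ℤ.i*j≡0⇒i≡0∨j≡0 (+ 2) (trans (sym (double i)) eq)
  where
  double : ∀ i → i + i ≡ + 2 * i
  double = solve-∀
... | inj₂ i≡0 = i≡0

-- c - a and c + a divide each other, so they agree up to sign: equality kills a, opposite signs
-- kill c. This rules out b₄ = -b₂ when b₃ = -b₁.
mutual-∣⇒≡0 : ∀ {a c} → c - a ∣ˢ - a - c → - a - c ∣ˢ - c - - a → c ≡ 0ℤ ⊎ a ≡ 0ℤ
mutual-∣⇒≡0 {a} {c} p q with ∣-antisym p (subst (- a - c ∣ˢ_) (swap a c) (∣m⇒∣-m q))
  where
  swap : ∀ a c → - (- c - - a) ≡ c - a
  swap = solve-∀
... | inj₁ eq = inj₁ (i+i≡0⇒i≡0 (trans (shift c a) (trans (cong (_+ (c + a)) eq) (cancel a c))))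
  where
  shift : ∀ c a → c + c ≡ (c - a) + (c + a)
  shift = solve-∀
  cancel : ∀ a c → - a - c + (c + a) ≡ 0ℤ
  cancel = solve-∀
... | inj₂ eq = inj₂ (i+i≡0⇒i≡0 (trans (shift c a) (trans (cong (λ d → (c + a) - d) eq) (cancel a c))))
  where
  shift : ∀ c a → a + a ≡ (c + a) - (c - a)
  shift = solve-∀
  cancel : ∀ a c → (c + a) - (- (- a - c)) ≡ 0ℤ
  cancel = solve-∀

module _ (f : Poly) (sp : StrictlyPreperiodic f 0ℤ) (x₀ : ℤ) (wandering : Wandering f x₀) where
  open OrbitOfZero f sp

  private
    a = b 1
    c = b 2

    avoids : ∀ n k → iter f n x₀ ≢ b k
    avoids = wandering-avoids x₀ wandering

    moves : ∀ n → iter f n x₀ ≢ iter f (suc n) x₀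
    moves n = wandering n (suc n) (ℕ.1+n≢n ∘ sym)

    x∤b₂₊ : b 3 ≡ a → ∀ n → ¬ (iter f (3 ℕ.+ n) x₀ ∣ˢ c)
    x∤b₂₊ b₃≡a n y₃∣c = Predecessors.no-three-links 0ℤ c a a c
      (noThreeStep₊ c ∣c∣≤6 a (ℕ.≤-trans (∣⇒∣∣≤ b₁∣b₂ (b≢0 1)) ∣c∣≤6)
        (iter f (3 ℕ.+ n) x₀) (ℕ.≤-trans (∣⇒∣∣≤ y₃∣c (b≢0 1)) ∣c∣≤6)
        (b≢0 1) fixed⊎unit y₃∣c (avoids (3 ℕ.+ n) 2) (avoids (3 ℕ.+ n) 1))
      (avoids (3 ℕ.+ n) 1) (link n) (link (suc n)) (link (2 ℕ.+ n))
      where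
      collision : ∀ x → (x - 0ℤ) * (x - c) ∣ˢ eval f x - a
      collision = collision-∣ f (b≢0 1 ∘ sym) (sym b₃≡a)
      link : ∀ n → Link 0ℤ c a a c (iter f n x₀) (iter f (suc n) x₀)
      link n = (avoids n 0 , avoids n 2 , avoids n 1 , moves n) ,
        collision (iter f n x₀) , eval-cong-∣ f (iter f n x₀) a
      -- At x = a the collision says that a (a - c) divides f(a) - a = c - a; if c ≠ a, cancelling
      -- leaves a ∣ 1.
      fixed⊎unit : c ≡ a ⊎ ∣ a ∣ ≡ 1
      fixed⊎unit with c ≟ a
      ... | yes c≡a = inj₁ c≡a
      ... | no  c≢a = inj₂ (ℕ.∣1⇒≡1 (ℕ.*-cancelʳ-∣ ∣ a - c ∣
        {{ℕ.≢-nonZero (≢⇒-≢0 (c≢a ∘ sym) ∘ ℤ.∣i∣≡0⇒i≡0)}}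
        (subst₂ ℕ._∣_
          (trans (ℤ.abs-* (a - 0ℤ) (a - c)) (cong (λ i → ∣ i ∣ ℕ.* ∣ a - c ∣) (ℤ.+-identityʳ a)))
          (trans (ℤ.∣i-j∣≡∣j-i∣ c a) (sym (ℕ.*-identityˡ _)))
          (∣⇒∣ᵤ (collision a)))))
      ∣c∣≤6 : ∣ c ∣ ≤ 6
      ∣c∣≤6 with fixed⊎unit
      ... | inj₁ c≡a = fixed-bound (link n) (link (suc n)) (link (2 ℕ.+ n))
        (avoids (3 ℕ.+ n) 1) (∣⇒∣∣≤ y₃∣c (b≢0 1)) c≡a
      ... | inj₂ ∣a∣≡1 = ℕ.≤-trans
        (unit-bound (link n) (link (suc n)) (link (2 ℕ.+ n))
          (avoids (3 ℕ.+ n) 1) (∣⇒∣∣≤ y₃∣c (b≢0 1)) ∣a∣≡1)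
        (s≤s (s≤s (s≤s z≤n)))

    b₄≡b₂ : b 3 ≡ - a → b 4 ≡ c
    b₄≡b₂ b₃≡-a =
      [ (λ b₄≡c → b₄≡c) , (λ b₄≡-c → contradiction (impossible b₄≡-c) [ b≢0 1 , b≢0 0 ]′) ]′ b₄≡±b₂
      where
      impossible : b 4 ≡ - c → c ≡ 0ℤ ⊎ a ≡ 0ℤ
      impossible b₄≡-c = mutual-∣⇒≡0
        (subst (λ i → c - a ∣ˢ i - c) b₃≡-a (eval-cong-∣ f c a))
        -- The congruence between the points b₃ = -a and c, with images b₄ = -c and b₃ = -a.
        (subst₂ (λ i j → i - c ∣ˢ j - i) b₃≡-a b₄≡-c (eval-cong-∣ f (b 3) c))

    x∤b₂₋ : b 3 ≡ - a → ∀ n → ¬ (iter f (3 ℕ.+ n) x₀ ∣ˢ c)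
    x∤b₂₋ b₃≡-a n y₃∣c = Predecessors.no-three-links a (- a) c 0ℤ a
      (noThreeStep₋ a ∣a∣≤2 c ∣c∣≤6 (iter f (3 ℕ.+ n) x₀) (ℕ.≤-trans (∣⇒∣∣≤ y₃∣c (b≢0 1)) ∣c∣≤6)
        (b≢0 0) (b≢0 1) c≢a a²∣a-c c-a∣c+a [c-a][c+a]∣c+a y₃∣c
        (avoids (3 ℕ.+ n) 1) (≢-a (3 ℕ.+ n)) (avoids (3 ℕ.+ n) 2))
      (avoids (3 ℕ.+ n) 2) (link n) (link (suc n)) (link (2 ℕ.+ n))
      where
      a≢-a : a ≢ - a
      a≢-a eq = b≢0 0 (i+i≡0⇒i≡0 (trans (cong (λ i → a + i) eq) (ℤ.+-inverseʳ a)))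
      -- If c = a, then a is fixed by f and b₃ = a, against b₃ = -a.
      c≢a : c ≢ a
      c≢a c≡a = a≢-a (trans (trans (sym c≡a) (cong (eval f) (sym c≡a))) b₃≡-a)
      collision : ∀ x → (x - a) * (x - - a) ∣ˢ eval f x - c
      collision = collision-∣ f a≢-a (trans (sym (b₄≡b₂ b₃≡-a)) (cong (eval f) b₃≡-a))
      ≢-a : ∀ n → iter f n x₀ ≢ - a
      ≢-a n eq = avoids n 3 (trans eq (sym b₃≡-a))
      link : ∀ n → Link a (- a) c 0ℤ a (iter f n x₀) (iter f (suc n) x₀)
      link n = (avoids n 1 , ≢-a n , avoids n 2 , moves n) ,
        collision (iter f n x₀) , eval-cong-∣ f (iter f n x₀) 0ℤ
      -- Since f(c) = b₃ = -a, divisibilities of f(c) - c become divisibilities of c + a; they are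
      -- obtained below from the congruence of c with a and from the collision at c.
      negated : ∀ {d} → d ∣ˢ b 3 - c → d ∣ˢ c + a
      negated {d} d∣ = subst (d ∣ˢ_) (trans (cong (λ i → - (i - c)) b₃≡-a) (negate a c)) (∣m⇒∣-m d∣)
        where
        negate : ∀ a c → - (- a - c) ≡ c + a
        negate = solve-∀
      -- The collision at 0, where f takes the value a.
      a²∣a-c : a * a ∣ˢ a - c
      a²∣a-c = ∣-trans (divides (- + 1) (square a)) (collision 0ℤ)
        where
        square : ∀ a → (0ℤ - a) * (0ℤ - - a) ≡ - + 1 * (a * a)
        square = solve-∀
      c-a∣c+a : c - a ∣ˢ c + a
      c-a∣c+a = negated (eval-cong-∣ f c a)
      [c-a][c+a]∣c+a : (c - a) * (c + a) ∣ˢ c + a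
      [c-a][c+a]∣c+a = subst (λ i → (c - a) * (c + i) ∣ˢ c + a) (ℤ.neg-involutive a)
        (negated (collision c))
      ∣c-a∣≤2∣a∣ : ∣ c - a ∣ ≤ ∣ a ∣ ℕ.+ ∣ a ∣
      ∣c-a∣≤2∣a∣ = ℕ.≤-trans
        (∣⇒∣∣≤ (subst (c - a ∣ˢ_) (difference c a) (∣m∣n⇒∣m-n c-a∣c+a ∣-refl)) (b≢0 0 ∘ i+i≡0⇒i≡0))
        (ℤ.∣i+j∣≤∣i∣+∣j∣ a a)
        where
        difference : ∀ c a → (c + a) - (c - a) ≡ a + a
        difference = solve-∀
      ∣a∣≤2 : ∣ a ∣ ≤ 2
      ∣a∣≤2 = ℕ.*-cancelʳ-≤ (∣ a ∣) 2 (∣ a ∣) {{ℕ.≢-nonZero (b≢0 0 ∘ ℤ.∣i∣≡0⇒i≡0)}} (begin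
        ∣ a ∣ ℕ.* ∣ a ∣     ≡⟨ ℤ.abs-* a a ⟨
        ∣ a * a ∣           ≤⟨ ∣⇒∣∣≤ a²∣a-c (≢⇒-≢0 (c≢a ∘ sym)) ⟩
        ∣ a - c ∣           ≡⟨ ℤ.∣i-j∣≡∣j-i∣ a c ⟩
        ∣ c - a ∣           ≤⟨ ∣c-a∣≤2∣a∣ ⟩
        ∣ a ∣ ℕ.+ ∣ a ∣     ≡⟨ cong (∣ a ∣ ℕ.+_) (ℕ.+-identityʳ ∣ a ∣) ⟨
        2 ℕ.* ∣ a ∣         ∎)
        where open ℕ.≤-Reasoning
      ∣c∣≤6 : ∣ c ∣ ≤ 6
      ∣c∣≤6 = begin
        ∣ c ∣                            ≤⟨ ∣j∣≤∣i∣+∣i-j∣ a c ⟩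
        ∣ a ∣ ℕ.+ ∣ a - c ∣              ≡⟨ cong (∣ a ∣ ℕ.+_) (ℤ.∣i-j∣≡∣j-i∣ a c) ⟩
        ∣ a ∣ ℕ.+ ∣ c - a ∣              ≤⟨ ℕ.+-monoʳ-≤ ∣ a ∣ ∣c-a∣≤2∣a∣ ⟩
        ∣ a ∣ ℕ.+ (∣ a ∣ ℕ.+ ∣ a ∣)      ≤⟨ ℕ.+-mono-≤ ∣a∣≤2 (ℕ.+-mono-≤ ∣a∣≤2 ∣a∣≤2) ⟩
        6                                ∎
        where open ℕ.≤-Reasoning

  x∤ell : ∀ n → ¬ (iter f (3 ℕ.+ n) x₀ ∣ˢ ell f)
  x∤ell n x∣ell = [ (λ eq → x∤b₂₊ eq n x∣b₂) , (λ eq → x∤b₂₋ eq n x∣b₂) ]′ b₃≡±b₁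
    where
    x∣b₂ : iter f (3 ℕ.+ n) x₀ ∣ˢ c
    x∣b₂ = ∣-trans x∣ell ell∣b₂

theorem3 : (f : Poly) → StrictlyPreperiodic f (+ 0) →
    (x₀ : ℤ) → Wandering f x₀ →
    ((m n : ℕ) → m ≢ n → Coprime (aSeq f x₀ m) (aSeq f x₀ n))
    × ((n : ℕ) → n ≥ 3 →
    Σ ℕ λ p → Prime p × ((+ p) ∣ aSeq f x₀ n)
    × ((m : ℕ) → m ≢ n → ¬ ((+ p) ∣ aSeq f x₀ m)))
theorem3 f sp x₀ wandering = aSeq-coprime f sp x₀ , private-prime
  where
  nonunit : ∀ n → n ≥ 3 → ∣ aSeq f x₀ n ∣ ≢ 1
  nonunit _ (s≤s (s≤s (s≤s {n = n} _))) =
    x∤ell f sp x₀ wandering n ∘ unit-aSeq⇒∣ell f x₀ (3 ℕ.+ n) (OrbitOfZero.ell≢0 f sp)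
  private-prime : ∀ n → n ≥ 3 → Σ ℕ λ p → Prime p × (+ p ∣ aSeq f x₀ n) ×
    (∀ m → m ≢ n → ¬ (+ p ∣ aSeq f x₀ m))
  private-prime n n≥3 = p , p-prime , p∣aₙ , λ m m≢n p∣aₘ →
    -- A second term divisible by p would have p as a common divisor with a_n, forcing p = 1.
    ¬prime[1] (subst Prime (aSeq-coprime f sp x₀ m n m≢n (p∣aₘ , p∣aₙ)) p-prime)
    where
    divisor = ≢1⇒prime-divisor ∣ aSeq f x₀ n ∣ (nonunit n n≥3)
    p = proj₁ divisor
    p-prime = proj₁ (proj₂ divisor)
    p∣aₙ = proj₂ (proj₂ divisor)
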